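{- Let $D$ be a domain, let $K\subseteq D$ and let $F\subseteq K$ be decidable on $K$. (1) If $K$ is exhaustible then so is $K\cap F$. (2) If $K$ is searchable then so is $K\cap F$, provided it is non-empty.
   Context: Domains are the objects of a fixed cartesian closed category of effectively given domains (for instance effectively given Scott domains, i.e. algebraic, bounded complete, directed complete posets), containing the flat domain $\mathcal{B}=\{0,1,\bot\}$ of booleans. $(D\to E)$ denotes the domain of Scott continuous maps ordered pointwise. "Computable" is meant in the standard sense for effectively given domains; computable maps are continuous. A predicate $p\in(D\to\mathcal{B})$ is defined on $K\subseteq D$ if $p(x)\neq\bot$ for all $x\in K$. $K$ is exhaustible if there is a computable $\forall_K:(D\to\mathcal{B})\to\mathcal{B}$ such that for every $p$ defined on $K$, $\forall_K(p)=1$ if $p(x)=1$ for all $x\in K$, and $\forall_K(p)=0$ if $p(x)=0$ for some $x\in K$. $K$ is searchable if there is a computable $\varepsilon_K:(D\to\mathcal{B})\to D$ such that for every $p$ defined on $K$: $\varepsilon_K(p)\in K$, and $p(\varepsilon_K(p))=1$ if $p(x)=1$ for some $x\in K$. A set $F\subseteq K$ is decidable on $K$ if there is a computable map $\psi_F:D\to\mathcal{B}$ defined on $K$ such that, for all $x\in K$, $\psi_F(x)=1$ iff $x\in F$. -}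

module Defs where

open import Axiom.ExcludedMiddle using (ExcludedMiddle)
open import Data.Empty using (⊥-elim)
open import Data.Fin using (Fin)
open import Data.Nat using (ℕ; zero; suc)
open import Data.Product using (Σ; ∃; _×_; _,_; proj₁; proj₂)
open import Data.Product.Relation.Binary.Pointwise.NonDependent using (×-poset)
open import Data.Unit.Polymorphic using (tt)
import Data.Unit.Polymorphic.Properties as Unit
open import Data.Vec using (Vec; []; _∷_; lookup)
open import Function.Base using (_∘_)
open import Function.Bundles using (_⇔_)
open import Level using (Level; Setω; _⊔_; 0ℓ) renaming (suc to lsuc)
open import Relation.Binary.Bundles using (Poset)
open import Relation.Binary.Definitions using (Minimum)
open import Relation.Binary.PropositionalEquality using (_≡_; refl; isEquivalence)
open import Relation.Nullary using (¬_; Dec; yes; no)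
open import Relation.Unary using (Pred; _∈_)

private
  variable
    ℓ o i k f : Level

1ℓ : Level
1ℓ = lsuc 0ℓ

-- Domain theory is developed classically; for instance, directed completeness
-- of the flat booleans is not provable constructively.
Classical : Setω
Classical = ∀ {ℓ} → ExcludedMiddle ℓ

data PrimRec : ℕ → Set where
  zeroᶠ : PrimRec 0
  sucᶠ  : PrimRec 1
  projᶠ : ∀ {n} → Fin n → PrimRec n
  compᶠ : ∀ {m n} → PrimRec m → Vec (PrimRec n) m → PrimRec n
  recᶠ  : ∀ {n} → PrimRec n → PrimRec (suc (suc n)) → PrimRec (suc n)

mutual
  ⟦_⟧ : ∀ {n} → PrimRec n → Vec ℕ n → ℕ
  ⟦ zeroᶠ ⟧ _ = 0
  ⟦ sucᶠ ⟧ (x ∷ []) = suc x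
  ⟦ projᶠ j ⟧ xs = lookup xs j
  ⟦ compᶠ g hs ⟧ xs = ⟦ g ⟧ (⟦ hs ⟧* xs)
  ⟦ recᶠ g h ⟧ (zero ∷ xs) = ⟦ g ⟧ xs
  ⟦ recᶠ g h ⟧ (suc x ∷ xs) = ⟦ h ⟧ (x ∷ ⟦ recᶠ g h ⟧ (x ∷ xs) ∷ xs)

  ⟦_⟧* : ∀ {m n} → Vec (PrimRec n) m → Vec ℕ n → Vec ℕ m
  ⟦ [] ⟧* xs = []
  ⟦ h ∷ hs ⟧* xs = ⟦ h ⟧ xs ∷ ⟦ hs ⟧* xs

-- Σ₁ form: a relation is r.e. iff it is the projection of a primitive
-- recursive one.
RecursivelyEnumerable : (ℕ → ℕ → Set ℓ) → Set ℓ
RecursivelyEnumerable R =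
  Σ (PrimRec 3) λ c → ∀ m n → R m n ⇔ (∃ λ t → ⟦ c ⟧ (t ∷ m ∷ n ∷ []) ≡ 0)

module _ (P : Poset 1ℓ 1ℓ 1ℓ) where
  open Poset P

  Directed : {I : Set i} → (I → Carrier) → Set (i ⊔ 1ℓ)
  Directed {I = I} α =
    I × (∀ r s → ∃ λ t → α r ≤ α t × α s ≤ α t)

  IsLub : {I : Set i} → (I → Carrier) → Carrier → Set (i ⊔ 1ℓ)
  IsLub α x = (∀ r → α r ≤ x) × (∀ z → (∀ r → α r ≤ z) → x ≤ z)

-- Directed sets are given as families indexed by types in Set, while carriers
-- live in Set₁, so that function spaces stay at the same level. As every domain
-- below has a countable basis, this smallness is classically no restriction.
record Dcpo : Set (lsuc 1ℓ) where
  field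
    poset : Poset 1ℓ 1ℓ 1ℓ
  open Poset poset public
  field
    lub     : {I : Set} (α : I → Carrier) → Directed poset α → ∃ (IsLub poset α)
    ⊥       : Carrier
    minimum : Minimum _≤_ ⊥

  infix 4 _≪_
  _≪_ : Carrier → Carrier → Set 1ℓ
  x ≪ y = {I : Set} (α : I → Carrier) → Directed poset α →
          ∀ z → IsLub poset α z → y ≤ z → ∃ λ r → x ≤ α r

∣_∣ : Dcpo → Set 1ℓ
∣ D ∣ = Dcpo.Carrier D

-- Preservation of lubs of directed families includes monotonicity, since
-- x ≤ y says that y is the lub of the directed family {x , y}.
IsContinuous : (D E : Dcpo) → (∣ D ∣ → ∣ E ∣) → Set 1ℓ
IsContinuous D E g =
  {I : Set} (α : I → ∣ D ∣) → Directed (Dcpo.poset D) α →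
  ∀ x → IsLub (Dcpo.poset D) α x → IsLub (Dcpo.poset E) (g ∘ α) (g x)

record ContinuousMap (D E : Dcpo) : Set 1ℓ where
  constructor continuous
  infixl 20 _∙_
  field
    _∙_          : ∣ D ∣ → ∣ E ∣
    isContinuous : IsContinuous D E _∙_

open ContinuousMap public

unitᵈ : Dcpo
unitᵈ = record
  { poset   = Unit.≡-poset 1ℓ
  ; lub     = λ _ _ → tt , (λ _ → refl) , (λ _ _ → refl)
  ; ⊥       = tt
  ; minimum = λ _ → refl
  }

infixr 6 _×ᵈ_
_×ᵈ_ : Dcpo → Dcpo → Dcpo
D ×ᵈ E = record
  { poset   = ×-poset D.poset E.poset
  ; lub     = λ { α (r₀ , dir) →
      let (x , x-ub , x-least) = D.lub (proj₁ ∘ α) (r₀ , λ r s →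
            let (t , p , q) = dir r s in t , proj₁ p , proj₁ q)
          (y , y-ub , y-least) = E.lub (proj₂ ∘ α) (r₀ , λ r s →
            let (t , p , q) = dir r s in t , proj₂ p , proj₂ q)
      in (x , y)
       , (λ r → x-ub r , y-ub r)
       , (λ { (z , w) ub → x-least z (proj₁ ∘ ub) , y-least w (proj₂ ∘ ub) }) }
  ; ⊥       = D.⊥ , E.⊥
  ; minimum = λ { (x , y) → D.minimum x , E.minimum y }
  }
  where
  module D = Dcpo D
  module E = Dcpo E

_→-poset_ : Dcpo → Dcpo → Poset 1ℓ 1ℓ 1ℓ
D →-poset E = record
  { Carrier        = ContinuousMap D E
  ; _≈_            = λ g h → ∀ x → g ∙ x E.≈ h ∙ x
  ; _≤_            = λ g h → ∀ x → g ∙ x E.≤ h ∙ x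
  ; isPartialOrder = record
    { isPreorder = record
      { isEquivalence = record
        { refl  = λ _ → E.Eq.refl
        ; sym   = λ p x → E.Eq.sym (p x)
        ; trans = λ p q x → E.Eq.trans (p x) (q x)
        }
      ; reflexive = λ p x → E.reflexive (p x)
      ; trans     = λ p q x → E.trans (p x) (q x)
      }
    ; antisym = λ p q x → E.antisym (p x) (q x)
    }
  }
  where module E = Dcpo E

infixr 5 _→ᵈ_
_→ᵈ_ : Dcpo → Dcpo → Dcpo
D →ᵈ E = record
  { poset   = D →-poset E
  ; lub     = λ α dir →
      continuous (sup α dir) (sup-continuous α dir)
      , (λ r x → proj₁ (sup-isLub α dir x) r)
      , (λ z ub x → proj₂ (sup-isLub α dir x) (z ∙ x) (λ r → ub r x))
  ; ⊥       = continuous (λ _ → E.⊥)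
                (λ { _ (r₀ , _) _ _ → (λ _ → E.refl) , (λ _ ub → ub r₀) })
  ; minimum = λ g x → E.minimum (g ∙ x)
  }
  where
  module D = Dcpo D
  module E = Dcpo E
  module _ {I : Set} (α : I → ContinuousMap D E)
           (dir : Directed (D →-poset E) α) where
    at : ∀ x → ∃ (IsLub E.poset (λ r → α r ∙ x))
    at x = E.lub (λ r → α r ∙ x)
      (proj₁ dir , λ r s → let (t , p , q) = proj₂ dir r s in t , p x , q x)

    sup : ∣ D ∣ → ∣ E ∣
    sup x = proj₁ (at x)

    sup-isLub : ∀ x → IsLub E.poset (λ r → α r ∙ x) (sup x)
    sup-isLub x = proj₂ (at x)

    sup-continuous : IsContinuous D E sup
    sup-continuous β β-dir x x-lub =
      (λ s → proj₂ (sup-isLub (β s)) (sup x) (λ r →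
        E.trans (proj₁ (isContinuous (α r) β β-dir x x-lub) s)
                (proj₁ (sup-isLub x) r)))
      , (λ z ub → proj₂ (sup-isLub x) z (λ r →
        proj₂ (isContinuous (α r) β β-dir x x-lub) z (λ s →
          E.trans (proj₁ (sup-isLub (β s)) r) (ub s))))

data Bool⊥ : Set 1ℓ where
  ⊥ᵇ 0ᵇ 1ᵇ : Bool⊥

infix 4 _⊑ᵇ_
data _⊑ᵇ_ : Bool⊥ → Bool⊥ → Set 1ℓ where
  ⊥⊑  : ∀ {b} → ⊥ᵇ ⊑ᵇ b
  rfl : ∀ {b} → b ⊑ᵇ b

𝔹-poset : Poset 1ℓ 1ℓ 1ℓ
𝔹-poset = record
  { Carrier        = Bool⊥
  ; _≈_            = _≡_
  ; _≤_            = _⊑ᵇ_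
  ; isPartialOrder = record
    { isPreorder = record
      { isEquivalence = isEquivalence
      ; reflexive     = λ { refl → rfl }
      ; trans         = λ { ⊥⊑ _ → ⊥⊑ ; rfl q → q }
      }
    ; antisym = λ { ⊥⊑ ⊥⊑ → refl ; ⊥⊑ rfl → refl ; rfl _ → refl }
    }
  }

𝔹ᵈ : Classical → Dcpo
𝔹ᵈ em = record
  { poset   = 𝔹-poset
  ; lub     = lubᵇ
  ; ⊥       = ⊥ᵇ
  ; minimum = λ _ → ⊥⊑
  }
  where
  1-max : ∀ {b} → 1ᵇ ⊑ᵇ b → b ≡ 1ᵇ
  1-max rfl = refl

  0-max : ∀ {b} → 0ᵇ ⊑ᵇ b → b ≡ 0ᵇ
  0-max rfl = refl

  ⊑-resp : ∀ {b c d} → b ⊑ᵇ c → c ≡ d → b ⊑ᵇ d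
  ⊑-resp p refl = p

  attained : {I : Set} (α : I → Bool⊥) → Directed 𝔹-poset α →
             ∀ c → (∀ {b} → c ⊑ᵇ b → b ≡ c) →
             (∃ λ r → α r ≡ c) → IsLub 𝔹-poset α c
  attained α (_ , dir) _ c-max (r , refl) =
    (λ s → let (_ , p , q) = dir r s in ⊑-resp q (c-max p))
    , (λ _ ub → ub r)

  below : ∀ b → ¬ (b ≡ 1ᵇ) → ¬ (b ≡ 0ᵇ) → b ⊑ᵇ ⊥ᵇ
  below ⊥ᵇ _ _ = rfl
  below 0ᵇ _ q = ⊥-elim (q refl)
  below 1ᵇ p _ = ⊥-elim (p refl)

  lubᵇ : {I : Set} (α : I → Bool⊥) → Directed 𝔹-poset α → ∃ (IsLub 𝔹-poset α)
  lubᵇ α dir with em {P = ∃ λ r → α r ≡ 1ᵇ} | em {P = ∃ λ r → α r ≡ 0ᵇ}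
  ... | yes p | _     = 1ᵇ , attained α dir 1ᵇ 1-max p
  ... | no _  | yes q = 0ᵇ , attained α dir 0ᵇ 0-max q
  ... | no p  | no q  =
    ⊥ᵇ , (λ r → below (α r) (λ e → p (r , e)) (λ e → q (r , e))) , (λ _ _ → ⊥⊑)

-- An enumerated basis with r.e. way-below relation. For an algebraic domain
-- with an enumeration of its compact elements, basis m ≪ basis n is just
-- basis m ≤ basis n, so effectively given Scott domains are an instance.
record EffectivePresentation (D : Dcpo) : Set 1ℓ where
  open Dcpo D
  field
    basis : ℕ → Carrier
    basis-directed : ∀ x →
      Directed poset {I = Σ ℕ λ n → basis n ≪ x} (basis ∘ proj₁)
    basis-lub : ∀ x →
      IsLub poset {I = Σ ℕ λ n → basis n ≪ x} (basis ∘ proj₁) x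
    ≪-re : RecursivelyEnumerable (λ m n → basis m ≪ basis n)

record EffectiveDomain : Set (lsuc 1ℓ) where
  constructor _given-by_
  field
    dcpo         : Dcpo
    presentation : EffectivePresentation dcpo
  open Dcpo dcpo public
  open EffectivePresentation presentation public

open EffectiveDomain using (dcpo)

IsComputable : (D E : EffectiveDomain) → ContinuousMap (dcpo D) (dcpo E) → Set 1ℓ
IsComputable D E g = RecursivelyEnumerable (λ m n → E.basis m E.≪ g ∙ D.basis n)
  where
  module D = EffectiveDomain D
  module E = EffectiveDomain E

record ComputableMap (D E : EffectiveDomain) : Set 1ℓ where
  field
    map          : ContinuousMap (dcpo D) (dcpo E)
    isComputable : IsComputable D E map

open ComputableMap public

infixl 20 _·_
_·_ : ∀ {D E} → ComputableMap D E → ∣ dcpo D ∣ → ∣ dcpo E ∣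
g · x = map g ∙ x

-- A class of effectively given domains which, with all computable maps between
-- them as morphisms, is cartesian closed, with finite products and exponentials
-- carried by the usual order-theoretic ones, and contains the flat booleans.
-- Uniqueness in the universal properties is automatic, as equality of maps is
-- pointwise. The r.e. way-below relation determines the effective presentations
-- of the one-point domain and of the flat booleans up to computable isomorphism.
record CartesianClosedCategory (em : Classical) (o : Level) : Set (lsuc 1ℓ ⊔ lsuc o) where
  field
    Object : EffectiveDomain → Set o

    𝔹-given : EffectivePresentation (𝔹ᵈ em)
    𝟙-given : EffectivePresentation unitᵈ
    ×-given : ∀ {D E} → Object D → Object E → EffectivePresentation (dcpo D ×ᵈ dcpo E)
    ⇒-given : ∀ {D E} → Object D → Object E → EffectivePresentation (dcpo D →ᵈ dcpo E)

  𝔹 : EffectiveDomain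
  𝔹 = 𝔹ᵈ em given-by 𝔹-given

  𝟙 : EffectiveDomain
  𝟙 = unitᵈ given-by 𝟙-given

  infixr 6 _⊗_
  _⊗_ : ∀ {D E} → Object D → Object E → EffectiveDomain
  A ⊗ B = _ given-by ×-given A B

  infixr 5 _⇒_
  _⇒_ : ∀ {D E} → Object D → Object E → EffectiveDomain
  A ⇒ B = _ given-by ⇒-given A B

  field
    𝔹-object : Object 𝔹
    𝟙-object : Object 𝟙
    ×-object : ∀ {D E} (A : Object D) (B : Object E) → Object (A ⊗ B)
    ⇒-object : ∀ {D E} (A : Object D) (B : Object E) → Object (A ⇒ B)

    π₁ : ∀ {D E} (A : Object D) (B : Object E) →
         ∃ λ (g : ComputableMap (A ⊗ B) D) →
         ∀ x y → EffectiveDomain._≈_ D (g · (x , y)) x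
    π₂ : ∀ {D E} (A : Object D) (B : Object E) →
         ∃ λ (g : ComputableMap (A ⊗ B) E) →
         ∀ x y → EffectiveDomain._≈_ E (g · (x , y)) y
    pair : ∀ {C D E} (_ : Object C) (A : Object D) (B : Object E)
           (g : ComputableMap C D) (h : ComputableMap C E) →
           ∃ λ (u : ComputableMap C (A ⊗ B)) →
           ∀ z → EffectiveDomain._≈_ (A ⊗ B) (u · z) (g · z , h · z)

    eval : ∀ {D E} (A : Object D) (B : Object E) →
           ∃ λ (e : ComputableMap (⇒-object A B ⊗ A) E) →
           ∀ g x → EffectiveDomain._≈_ E (e · (g , x)) (g ∙ x)
    curry : ∀ {C D E} (Z : Object C) (A : Object D) (B : Object E)
            (g : ComputableMap (Z ⊗ A) E) →
            ∃ λ (u : ComputableMap C (A ⇒ B)) →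
            ∀ z x → EffectiveDomain._≈_ E ((u · z) ∙ x) (g · (z , x))

-- Subsets are arbitrary predicates; they need not respect the setoid equality.
module _ {em : Classical} (𝒞 : CartesianClosedCategory em o) where
  open CartesianClosedCategory 𝒞

  DefinedOn : ∀ {D} → ContinuousMap (dcpo D) (dcpo 𝔹) → Pred ∣ dcpo D ∣ k → Set (1ℓ ⊔ k)
  DefinedOn p K = ∀ {x} → x ∈ K → ¬ (p ∙ x ≡ ⊥ᵇ)

  Exhaustible : ∀ {D} → Object D → Pred ∣ dcpo D ∣ k → Set (1ℓ ⊔ k)
  Exhaustible {D = D} A K =
    ∃ λ (∀ᴷ : ComputableMap (A ⇒ 𝔹-object) 𝔹) →
    (p : ContinuousMap (dcpo D) (dcpo 𝔹)) → DefinedOn {D = D} p K →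
      ((∀ {x} → x ∈ K → p ∙ x ≡ 1ᵇ) → ∀ᴷ · p ≡ 1ᵇ)
    × ((∃ λ x → x ∈ K × p ∙ x ≡ 0ᵇ) → ∀ᴷ · p ≡ 0ᵇ)

  Searchable : ∀ {D} → Object D → Pred ∣ dcpo D ∣ k → Set (1ℓ ⊔ k)
  Searchable {D = D} A K =
    ∃ λ (ε : ComputableMap (A ⇒ 𝔹-object) D) →
    (p : ContinuousMap (dcpo D) (dcpo 𝔹)) → DefinedOn {D = D} p K →
      (ε · p) ∈ K
    × ((∃ λ x → x ∈ K × p ∙ x ≡ 1ᵇ) → p ∙ (ε · p) ≡ 1ᵇ)

  DecidableOn : ∀ {D} → Object D → Pred ∣ dcpo D ∣ k → Pred ∣ dcpo D ∣ f → Set (1ℓ ⊔ k ⊔ f)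
  DecidableOn {D = D} A K F =
    ∃ λ (ψ : ComputableMap D 𝔹) →
      DefinedOn {D = D} (map ψ) K
    × (∀ {x} → x ∈ K → (ψ · x ≡ 1ᵇ) ⇔ (x ∈ F))

{-# OPTIONS --safe #-}

-- Let ⇒ and ∧ be sequential implication and conjunction, evaluated from the
-- left, so that ψ ⇒ p and ψ ∧ p are defined on all of K as soon as p is defined
-- on K ∩ F. Universal quantification over K ∩ F is then p ↦ ∀ᴷ (ψ ⇒ p). For the
-- search, put r = ψ ∧ p; p has a solution in K ∩ F iff e = r (ε r) is 1. The
-- point ε (ψ ∧ (e ⇒ p)) is such a solution if there is one, and some element of
-- K ∩ F otherwise. So boolean operations suffice: no conditional with values in
-- D is needed.
--
-- The effective presentations being abstract, it remains to see that computable
-- maps compose, by interpolation of ≪, and that the boolean operations are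
-- computable. The latter holds since all three booleans are basis elements and
-- the projections are computable.

module Submission where

open import Defs
open import Data.Bool using (Bool; true; false)
open import Data.Empty using (⊥-elim)
open import Data.Fin using (Fin; zero; suc)
open import Data.Nat using (ℕ; zero; suc; _+_; _*_; _<_; _⊔_; s≤s)
open import Data.Nat.Properties
  using (1+n≢0; m+n≡0⇒m≡0; m+n≡0⇒n≡0; m*n≡0⇒m≡0∨n≡0; *-zeroʳ; m<n⇒m<1+n; n<1+n;
         m<1+n⇒m<n∨m≡n; m≤m⊔n; m≤n⊔m)
open import Data.Product using (Σ; ∃; ∃₂; _×_; _,_; proj₁; proj₂)
open import Data.Sum using (_⊎_; inj₁; inj₂)
open import Data.Unit using (⊤)
open import Data.Vec using (Vec; []; _∷_; lookup; tabulate)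
open import Data.Vec.Properties using (tabulate∘lookup)
open import Function.Base using (_∘_)
open import Function.Bundles using (_⇔_; mk⇔; Equivalence)
open import Level using (Level)
open import Relation.Binary.PropositionalEquality
  using (_≡_; refl; sym; trans; cong; cong₂; subst; subst₂)
open import Relation.Nullary using (¬_; yes; no)
open import Relation.Nullary.Decidable using (True; toWitness; fromWitness)
open import Relation.Unary using (Pred; _∈_; _⊆_; _∩_; Satisfiable)

open Equivalence using (to; from)

private
  variable
    ℓ ℓ′ o k f : Level
    m n : ℕ

-- Recursively enumerable relations

constᶠ : ℕ → PrimRec n
constᶠ zero    = compᶠ zeroᶠ []
constᶠ (suc a) = compᶠ sucᶠ (constᶠ a ∷ [])

⟦constᶠ⟧ : ∀ a (xs : Vec ℕ n) → ⟦ constᶠ a ⟧ xs ≡ a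
⟦constᶠ⟧ zero    xs = refl
⟦constᶠ⟧ (suc a) xs = cong suc (⟦constᶠ⟧ a xs)

addᶠ : PrimRec 2
addᶠ = recᶠ (projᶠ zero) (compᶠ sucᶠ (projᶠ (suc zero) ∷ []))

⟦addᶠ⟧ : ∀ x y → ⟦ addᶠ ⟧ (x ∷ y ∷ []) ≡ x + y
⟦addᶠ⟧ zero    y = refl
⟦addᶠ⟧ (suc x) y = cong suc (⟦addᶠ⟧ x y)

mulᶠ : PrimRec 2
mulᶠ = recᶠ (constᶠ 0) (compᶠ addᶠ (projᶠ (suc (suc zero)) ∷ projᶠ (suc zero) ∷ []))

⟦mulᶠ⟧ : ∀ x y → ⟦ mulᶠ ⟧ (x ∷ y ∷ []) ≡ x * y
⟦mulᶠ⟧ zero    y = refl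
⟦mulᶠ⟧ (suc x) y = trans (⟦addᶠ⟧ y _) (cong (y +_) (⟦mulᶠ⟧ x y))

infixl 6 _+ᶠ_
infixl 7 _*ᶠ_

-- With the value 0 read as truth, a sum is a conjunction and a product is a disjunction.
_+ᶠ_ _*ᶠ_ : PrimRec n → PrimRec n → PrimRec n
c +ᶠ d = compᶠ addᶠ (c ∷ d ∷ [])
c *ᶠ d = compᶠ mulᶠ (c ∷ d ∷ [])

module _ (c d : PrimRec n) (xs : Vec ℕ n) where

  +ᶠ-zero : ⟦ c +ᶠ d ⟧ xs ≡ 0 ⇔ (⟦ c ⟧ xs ≡ 0 × ⟦ d ⟧ xs ≡ 0)
  +ᶠ-zero = mk⇔
    (λ e → let e′ = trans (sym (⟦addᶠ⟧ (⟦ c ⟧ xs) _)) e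
           in m+n≡0⇒m≡0 _ e′ , m+n≡0⇒n≡0 (⟦ c ⟧ xs) e′)
    (λ (p , q) → trans (⟦addᶠ⟧ (⟦ c ⟧ xs) _) (cong₂ _+_ p q))

  *ᶠ-zero : ⟦ c *ᶠ d ⟧ xs ≡ 0 ⇔ (⟦ c ⟧ xs ≡ 0 ⊎ ⟦ d ⟧ xs ≡ 0)
  *ᶠ-zero = mk⇔
    (λ e → m*n≡0⇒m≡0∨n≡0 (⟦ c ⟧ xs) (trans (sym (⟦mulᶠ⟧ (⟦ c ⟧ xs) _)) e))
    (λ { (inj₁ p) → trans (⟦mulᶠ⟧ (⟦ c ⟧ xs) _) (cong (_* _) p)
       ; (inj₂ q) → trans (⟦mulᶠ⟧ (⟦ c ⟧ xs) _)
                      (trans (cong (⟦ c ⟧ xs *_) q) (*-zeroʳ (⟦ c ⟧ xs))) })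

projsᶠ : (Fin m → Fin n) → Vec (PrimRec n) m
projsᶠ ρ = tabulate (projᶠ ∘ ρ)

⟦projsᶠ⟧ : (ρ : Fin m → Fin n) (xs : Vec ℕ n) →
           ⟦ projsᶠ ρ ⟧* xs ≡ tabulate (lookup xs ∘ ρ)
⟦projsᶠ⟧ {m = zero}  ρ xs = refl
⟦projsᶠ⟧ {m = suc m} ρ xs = cong (lookup xs (ρ zero) ∷_) (⟦projsᶠ⟧ (ρ ∘ suc) xs)

⟦projsᶠ⟧-suc² : ∀ x y (xs : Vec ℕ n) →
                ⟦ projsᶠ (λ i → suc (suc i)) ⟧* (x ∷ y ∷ xs) ≡ xs
⟦projsᶠ⟧-suc² x y xs = trans (⟦projsᶠ⟧ _ (x ∷ y ∷ xs)) (tabulate∘lookup xs)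

-- The product of c (t ∷ xs) over t < u.
searchᶠ : PrimRec (suc n) → PrimRec (suc n)
searchᶠ c = recᶠ (constᶠ 1)
  (projᶠ (suc zero) *ᶠ compᶠ c (projᶠ zero ∷ projsᶠ (λ i → suc (suc i))))

⟦searchᶠ⟧-zero : (c : PrimRec (suc n)) (u : ℕ) (xs : Vec ℕ n) →
  ⟦ searchᶠ c ⟧ (u ∷ xs) ≡ 0 ⇔ (∃ λ t → t < u × ⟦ c ⟧ (t ∷ xs) ≡ 0)
⟦searchᶠ⟧-zero c zero    xs = mk⇔ (λ e → ⊥-elim (1+n≢0 (trans (sym (⟦constᶠ⟧ 1 xs)) e)))
                                  (λ { (_ , () , _) })
⟦searchᶠ⟧-zero {n} c (suc u) xs = mk⇔ forth back
  where
  IH = ⟦searchᶠ⟧-zero c u xs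
  last = compᶠ c (projᶠ zero ∷ projsᶠ (λ i → suc (suc i)))
  ys = u ∷ ⟦ searchᶠ c ⟧ (u ∷ xs) ∷ xs

  last≡ : ⟦ last ⟧ ys ≡ ⟦ c ⟧ (u ∷ xs)
  last≡ = cong (λ zs → ⟦ c ⟧ (u ∷ zs)) (⟦projsᶠ⟧-suc² u _ xs)

  factor = *ᶠ-zero (projᶠ (suc zero)) last ys

  forth : ⟦ searchᶠ c ⟧ (suc u ∷ xs) ≡ 0 → ∃ λ t → t < suc u × ⟦ c ⟧ (t ∷ xs) ≡ 0
  forth e with to factor e
  ... | inj₁ p = let (t , t<u , q) = to IH p in t , m<n⇒m<1+n t<u , q
  ... | inj₂ p = u , n<1+n u , trans (sym last≡) p

  back : (∃ λ t → t < suc u × ⟦ c ⟧ (t ∷ xs) ≡ 0) → ⟦ searchᶠ c ⟧ (suc u ∷ xs) ≡ 0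
  back (t , t<1+u , q) with m<1+n⇒m<n∨m≡n t<1+u
  ... | inj₁ t<u  = from factor (inj₁ (from IH (t , t<u , q)))
  ... | inj₂ refl = from factor (inj₂ (trans last≡ q))

-- Merges two unbounded witnesses into one without a pairing function: the new witness `u` is a
-- common bound, below which both old witnesses are searched.
dovetailᶠ : PrimRec (suc (suc n)) → PrimRec (suc n)
dovetailᶠ c = compᶠ
  (searchᶠ (compᶠ (searchᶠ c)
    (projᶠ (suc zero) ∷ projᶠ zero ∷ projsᶠ (λ i → suc (suc i)))))
  -- Here `u` is duplicated: the first copy bounds the outer search, the second stays a parameter
  -- and becomes the bound of the inner one.
  (projᶠ zero ∷ projsᶠ (λ i → i))

⟦dovetailᶠ⟧-zero : (c : PrimRec (suc (suc n))) (xs : Vec ℕ n) →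
  (∃ λ u → ⟦ dovetailᶠ c ⟧ (u ∷ xs) ≡ 0) ⇔ (∃₂ λ s t → ⟦ c ⟧ (s ∷ t ∷ xs) ≡ 0)
⟦dovetailᶠ⟧-zero c xs = mk⇔ forth back
  where
  swapped = compᶠ (searchᶠ c)
    (projᶠ (suc zero) ∷ projᶠ zero ∷ projsᶠ (λ i → suc (suc i)))

  swapped≡ : ∀ t u → ⟦ swapped ⟧ (t ∷ u ∷ xs) ≡ ⟦ searchᶠ c ⟧ (u ∷ t ∷ xs)
  swapped≡ t u = cong (λ zs → ⟦ searchᶠ c ⟧ (u ∷ t ∷ zs)) (⟦projsᶠ⟧-suc² t u xs)

  dovetail≡ : ∀ u → ⟦ dovetailᶠ c ⟧ (u ∷ xs) ≡ ⟦ searchᶠ swapped ⟧ (u ∷ u ∷ xs)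
  dovetail≡ u = cong (λ zs → ⟦ searchᶠ swapped ⟧ (u ∷ zs))
    (trans (⟦projsᶠ⟧ (λ i → i) (u ∷ xs)) (tabulate∘lookup (u ∷ xs)))

  forth : (∃ λ u → ⟦ dovetailᶠ c ⟧ (u ∷ xs) ≡ 0) → ∃₂ λ s t → ⟦ c ⟧ (s ∷ t ∷ xs) ≡ 0
  forth (u , e) =
    let (t , _ , p) = to (⟦searchᶠ⟧-zero swapped u (u ∷ xs)) (trans (sym (dovetail≡ u)) e)
        (s , _ , q) = to (⟦searchᶠ⟧-zero c u (t ∷ xs)) (trans (sym (swapped≡ t u)) p)
    in s , t , q

  back : (∃₂ λ s t → ⟦ c ⟧ (s ∷ t ∷ xs) ≡ 0) → ∃ λ u → ⟦ dovetailᶠ c ⟧ (u ∷ xs) ≡ 0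
  back (s , t , e) = u , trans (dovetail≡ u)
      (from (⟦searchᶠ⟧-zero swapped u (u ∷ xs))
        (t , s≤s (m≤n⊔m s t) , trans (swapped≡ t u)
          (from (⟦searchᶠ⟧-zero c u (t ∷ xs)) (s , s≤s (m≤m⊔n s t) , e))))
    -- The successor is taken because the searches range strictly below their bound.
    where u = suc (s ⊔ t)

-- Closure properties of r.e. relations

module _ {R : ℕ → ℕ → Set ℓ} {S : ℕ → ℕ → Set ℓ′} where

  re-resp-⇔ : (∀ m n → R m n ⇔ S m n) → RecursivelyEnumerable R → RecursivelyEnumerable S
  re-resp-⇔ R⇔S (c , h) = c , λ m n →
    mk⇔ (to (h m n) ∘ from (R⇔S m n)) (to (R⇔S m n) ∘ from (h m n))

  re-∪ : RecursivelyEnumerable R → RecursivelyEnumerable S →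
         RecursivelyEnumerable (λ m n → R m n ⊎ S m n)
  re-∪ (c , h) (d , g) = c *ᶠ d , λ m n → mk⇔
    (λ { (inj₁ p) → let (t , e) = to (h m n) p in t , from (*ᶠ-zero c d (t ∷ m ∷ n ∷ [])) (inj₁ e)
       ; (inj₂ p) → let (t , e) = to (g m n) p in t , from (*ᶠ-zero c d (t ∷ m ∷ n ∷ [])) (inj₂ e) })
    (λ (t , e) → case m n t (to (*ᶠ-zero c d (t ∷ m ∷ n ∷ [])) e))
    where
    case : ∀ m n t → ⟦ c ⟧ (t ∷ m ∷ n ∷ []) ≡ 0 ⊎ ⟦ d ⟧ (t ∷ m ∷ n ∷ []) ≡ 0 →
           R m n ⊎ S m n
    case m n t (inj₁ e) = inj₁ (from (h m n) (t , e))
    case m n t (inj₂ e) = inj₂ (from (g m n) (t , e))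

  re-∩ : RecursivelyEnumerable R → RecursivelyEnumerable S →
         RecursivelyEnumerable (λ m n → R m n × S m n)
  re-∩ (c , h) (d , g) = dovetailᶠ (c′ +ᶠ d′) , λ m n → mk⇔
    (λ (p , q) → let (s , e₁) = to (h m n) p
                     (t , e₂) = to (g m n) q
                 in from (⟦dovetailᶠ⟧-zero (c′ +ᶠ d′) (m ∷ n ∷ []))
                      (s , t , from (+ᶠ-zero c′ d′ (s ∷ t ∷ m ∷ n ∷ [])) (e₁ , e₂)))
    (λ p → let (s , t , e) = to (⟦dovetailᶠ⟧-zero (c′ +ᶠ d′) (m ∷ n ∷ [])) p
               (e₁ , e₂) = to (+ᶠ-zero c′ d′ (s ∷ t ∷ m ∷ n ∷ [])) e
           in from (h m n) (s , e₁) , from (g m n) (t , e₂))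
    where
    s₀ = zero ; t₀ = suc zero ; m₀ = suc (suc zero) ; n₀ = suc (suc (suc zero))
    c′ d′ : PrimRec 4
    c′ = compᶠ c (projᶠ s₀ ∷ projᶠ m₀ ∷ projᶠ n₀ ∷ [])
    d′ = compᶠ d (projᶠ t₀ ∷ projᶠ m₀ ∷ projᶠ n₀ ∷ [])

  -- Three existential witnesses have to become one: the inner dovetailing merges the witnesses `s`
  -- and `t` of the two relations, the outer one merges the result with the intermediate number `j`.
  re-∘ : RecursivelyEnumerable R → RecursivelyEnumerable S →
         RecursivelyEnumerable (λ m n → ∃ λ j → R m j × S j n)
  re-∘ (c , h) (d , g) = dovetailᶠ (dovetailᶠ (c′ +ᶠ d′)) , λ m n → mk⇔
    (λ (j , p , q) → let (s , e₁) = to (h m j) p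
                         (t , e₂) = to (g j n) q
                         (u , e) = from (⟦dovetailᶠ⟧-zero (c′ +ᶠ d′) (j ∷ m ∷ n ∷ []))
                                     (s , t , from (+ᶠ-zero c′ d′ (s ∷ t ∷ j ∷ m ∷ n ∷ [])) (e₁ , e₂))
                     in from (⟦dovetailᶠ⟧-zero (dovetailᶠ (c′ +ᶠ d′)) (m ∷ n ∷ [])) (u , j , e))
    (λ p → let (u , j , e) = to (⟦dovetailᶠ⟧-zero (dovetailᶠ (c′ +ᶠ d′)) (m ∷ n ∷ [])) p
               (s , t , e′) = to (⟦dovetailᶠ⟧-zero (c′ +ᶠ d′) (j ∷ m ∷ n ∷ [])) (u , e)
               (e₁ , e₂) = to (+ᶠ-zero c′ d′ (s ∷ t ∷ j ∷ m ∷ n ∷ [])) e′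
           in j , from (h m j) (s , e₁) , from (g j n) (t , e₂))
    where
    s₀ = zero ; t₀ = suc zero ; j₀ = suc (suc zero)
    m₀ = suc (suc (suc zero)) ; n₀ = suc (suc (suc (suc zero)))
    c′ d′ : PrimRec 5
    c′ = compᶠ c (projᶠ s₀ ∷ projᶠ m₀ ∷ projᶠ j₀ ∷ [])
    d′ = compᶠ d (projᶠ t₀ ∷ projᶠ j₀ ∷ projᶠ n₀ ∷ [])

module _ {R : ℕ → ℕ → Set ℓ} (a : ℕ) where

  re-fixˡ : RecursivelyEnumerable R → RecursivelyEnumerable (λ _ n → R a n)
  re-fixˡ (c , h) = c′ , λ m n → mk⇔
    (λ p → let (t , e) = to (h a n) p in t , trans (c′≡ t m n) e)
    (λ (t , e) → from (h a n) (t , trans (sym (c′≡ t m n)) e))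
    where
    c′ : PrimRec 3
    c′ = compᶠ c (projᶠ zero ∷ constᶠ a ∷ projᶠ (suc (suc zero)) ∷ [])
    c′≡ : ∀ t m n → ⟦ c′ ⟧ (t ∷ m ∷ n ∷ []) ≡ ⟦ c ⟧ (t ∷ a ∷ n ∷ [])
    c′≡ t m n = cong (λ b → ⟦ c ⟧ (t ∷ b ∷ n ∷ [])) (⟦constᶠ⟧ a _)

  re-fixʳ : RecursivelyEnumerable R → RecursivelyEnumerable (λ m _ → R m a)
  re-fixʳ (c , h) = c′ , λ m n → mk⇔
    (λ p → let (t , e) = to (h m a) p in t , trans (c′≡ t m n) e)
    (λ (t , e) → from (h m a) (t , trans (sym (c′≡ t m n)) e))
    where
    c′ : PrimRec 3
    c′ = compᶠ c (projᶠ zero ∷ projᶠ (suc zero) ∷ constᶠ a ∷ [])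
    c′≡ : ∀ t m n → ⟦ c′ ⟧ (t ∷ m ∷ n ∷ []) ≡ ⟦ c ⟧ (t ∷ m ∷ a ∷ [])
    c′≡ t m n = cong (λ b → ⟦ c ⟧ (t ∷ m ∷ b ∷ [])) (⟦constᶠ⟧ a _)

re-∃ᵇ : {R : Bool⊥ → ℕ → ℕ → Set ℓ} → (∀ b → RecursivelyEnumerable (R b)) →
        RecursivelyEnumerable (λ m n → ∃ λ b → R b m n)
re-∃ᵇ re = re-resp-⇔
  (λ m n → mk⇔
    (λ { (inj₁ p) → ⊥ᵇ , p ; (inj₂ (inj₁ p)) → 0ᵇ , p ; (inj₂ (inj₂ p)) → 1ᵇ , p })
    (λ { (⊥ᵇ , p) → inj₁ p ; (0ᵇ , p) → inj₂ (inj₁ p) ; (1ᵇ , p) → inj₂ (inj₂ p) }))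
  (re-∪ (re ⊥ᵇ) (re-∪ (re 0ᵇ) (re 1ᵇ)))

-- Continuous and computable maps

module _ {D E : Dcpo} (g : ContinuousMap D E) where
  private
    module D = Dcpo D
    module E = Dcpo E

  monotone : ∀ {x y} → x D.≤ y → g ∙ x E.≤ g ∙ y
  monotone {x} {y} x≤y = proj₁ (isContinuous g α (true , λ _ _ → false , below _ , below _) y
      (below , λ _ ub → ub false)) true
    where
    α : Bool → ∣ D ∣
    α true  = x
    α false = y
    below : ∀ b → α b D.≤ y
    below true  = x≤y
    below false = D.refl

  ∙-cong : ∀ {x y} → x D.≈ y → g ∙ x E.≈ g ∙ y
  ∙-cong x≈y = E.antisym (monotone (D.reflexive x≈y)) (monotone (D.reflexive (D.Eq.sym x≈y)))

  map-directed : {I : Set} {α : I → ∣ D ∣} →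
                 Directed D.poset α → Directed E.poset (λ i → g ∙ α i)
  map-directed (r₀ , dir) = r₀ , λ r s →
    let (t , p , q) = dir r s in t , monotone p , monotone q

infixr 9 _∘ᶜ_
_∘ᶜ_ : {C D E : Dcpo} → ContinuousMap D E → ContinuousMap C D → ContinuousMap C E
g ∘ᶜ h = continuous (λ x → g ∙ (h ∙ x)) λ α dir x lub →
  isContinuous g _ (map-directed h dir) _ (isContinuous h α dir x lub)

module WayBelow (D : Dcpo) where
  open Dcpo D renaming (refl to ≤-refl; trans to ≤-trans)

  ≪⇒≤ : ∀ {x y} → x ≪ y → x ≤ y
  ≪⇒≤ {y = y} x≪y = proj₂ (x≪y {I = ⊤} (λ _ → y) (_ , λ _ _ → _ , ≤-refl , ≤-refl) y
    ((λ _ → ≤-refl) , (λ _ ub → ub _)) ≤-refl)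

  ≪-≤-trans : ∀ {x y z} → x ≪ y → y ≤ z → x ≪ z
  ≪-≤-trans x≪y y≤z α dir w lub z≤w = x≪y α dir w lub (≤-trans y≤z z≤w)

  ≤-≪-trans : ∀ {x y z} → x ≤ y → y ≪ z → x ≪ z
  ≤-≪-trans x≤y y≪z α dir w lub z≤w =
    let (r , y≤αr) = y≪z α dir w lub z≤w in r , ≤-trans x≤y y≤αr

-- By excluded middle, the indexing type of the canonical approximating family
-- can be moved from Set₁ down to Set, as the definition of ≪ requires.
module Approximation (em : Classical) (D : EffectiveDomain) where
  open EffectiveDomain D renaming (refl to ≤-refl; trans to ≤-trans)
  open WayBelow dcpo

  Subset : (ℕ → Set 1ℓ) → Set
  Subset P = Σ ℕ λ n → True (em {P = P n})

  subset : ∀ P n → P n → Subset P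
  subset P n w = n , fromWitness {a? = em {P = P n}} w

  witness : ∀ P (r : Subset P) → P (proj₁ r)
  witness P (n , w) = toWitness {a? = em {P = P n}} w

  Approx : Carrier → ℕ → Set 1ℓ
  Approx x n = basis n ≪ x

  approx : ∀ x → Subset (Approx x) → Carrier
  approx x (n , _) = basis n

  approx-directed : ∀ x → Directed poset (approx x)
  approx-directed x =
    (let (n , n≪x) = proj₁ (basis-directed x) in subset (Approx x) n n≪x)
    , λ r s →
        let ((t , t≪x) , p , q) = proj₂ (basis-directed x)
              (proj₁ r , witness (Approx x) r) (proj₁ s , witness (Approx x) s)
        in subset (Approx x) t t≪x , p , q

  approx-lub : ∀ x → IsLub poset (approx x) x
  approx-lub x =
    (λ r → ≪⇒≤ (witness (Approx x) r))
    , λ z ub → proj₂ (basis-lub x) z (λ (r , r≪x) → ub (subset (Approx x) r r≪x))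

  -- The basis elements lying two steps of `≪` below `y` form a directed family with lub `y`, so
  -- `x ≪ y` puts `x` below one of them; its intermediate element is `k`.
  interpolation : ∀ {x y} → x ≪ y → ∃ λ k → x ≪ basis k × basis k ≪ y
  interpolation {x} {y} x≪y =
    let (r , x≤i) = x≪y α (inhabited , directed) y (upper , least) ≤-refl
        (k , i≪k , k≪y) = witness Between r
    in k , ≤-≪-trans x≤i i≪k , k≪y
    where
    Between : ℕ → Set 1ℓ
    Between i = ∃ λ k → basis i ≪ basis k × basis k ≪ y

    α : Subset Between → Carrier
    α (i , _) = basis i

    inhabited : Subset Between
    inhabited =
      let (k , k≪y) = proj₁ (basis-directed y)
          (i , i≪k) = proj₁ (basis-directed (basis k))
      in subset Between i (k , i≪k , k≪y)

    directed : ∀ r s → ∃ λ t → α r ≤ α t × α s ≤ α t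
    directed p q =
      let (k , i≪k , k≪y) = witness Between p
          (l , j≪l , l≪y) = witness Between q
          -- Both `basis i` and `basis j` are way below this common bound `basis h`, so approximants
          -- of `basis h` dominate them, and these approximants are directed.
          ((h , h≪y) , k≤h , l≤h) = proj₂ (basis-directed y) (k , k≪y) (l , l≪y)
          dir = approx-directed (basis h)
          below-h = λ {a} (a≪h : basis a ≪ basis h) →
            a≪h (approx (basis h)) dir (basis h) (approx-lub (basis h)) ≤-refl
          (r , i≤r) = below-h (≪-≤-trans i≪k k≤h)
          (s , j≤s) = below-h (≪-≤-trans j≪l l≤h)
          (t , r≤t , s≤t) = proj₂ dir r s
      in subset Between (proj₁ t) (h , witness (Approx (basis h)) t , h≪y)
       , ≤-trans i≤r r≤t , ≤-trans j≤s s≤t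

    upper : ∀ r → α r ≤ y
    upper r = let (k , i≪k , k≪y) = witness Between r in ≤-trans (≪⇒≤ i≪k) (≪⇒≤ k≪y)

    least : ∀ z → (∀ r → α r ≤ z) → y ≤ z
    least z ub = proj₂ (basis-lub y) z λ (k , k≪y) →
      proj₂ (basis-lub (basis k)) z λ (i , i≪k) → ub (subset Between i (k , i≪k , k≪y))

module _ (em : Classical) {C D E : EffectiveDomain} where
  private
    module C = EffectiveDomain C
    module D = EffectiveDomain D
    module E = EffectiveDomain E

  -- A basis element is way below `g (h n)` iff it is way below `g` of some basis element that is
  -- itself way below `h n`. This exhibits the graph of the composite as a composition of r.e.
  -- relations.
  compose : ComputableMap D E → ComputableMap C D → ComputableMap C E
  compose g h = record
    { map          = map g ∘ᶜ map h
    ; isComputable = re-resp-⇔ (λ m n → mk⇔ (forth m n) (back m n))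
                       (re-∘ (isComputable g) (isComputable h))
    }
    where
    open Approximation em
    module WD = WayBelow D.dcpo
    module WE = WayBelow E.dcpo

    forth : ∀ m n → (∃ λ j → E.basis m E.≪ g · D.basis j × D.basis j D.≪ h · C.basis n) →
            E.basis m E.≪ g · (h · C.basis n)
    forth m n (j , p , q) = WE.≪-≤-trans p (monotone (map g) (WD.≪⇒≤ q))

    back : ∀ m n → E.basis m E.≪ g · (h · C.basis n) →
           ∃ λ j → E.basis m E.≪ g · D.basis j × D.basis j D.≪ h · C.basis n
    back m n p =
      let y = h · C.basis n
          -- Continuity of `g` at `y` yields only `≤` below some `g` of an approximant; the
          -- interpolated `k` leaves room to recover `≪` for `basis m`.
          (k , m≪k , k≪gy) = interpolation E p
          (j , k≤gj) = k≪gy _ (map-directed (map g) (approx-directed D y)) _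
            (isContinuous (map g) _ (approx-directed D y) y (approx-lub D y)) E.refl
      in proj₁ j , WE.≪-≤-trans m≪k k≤gj , witness D (Approx D y) j

-- The flat booleans

⊑⊥⇒≡⊥ : ∀ {b} → b ⊑ᵇ ⊥ᵇ → b ≡ ⊥ᵇ
⊑⊥⇒≡⊥ ⊥⊑  = refl
⊑⊥⇒≡⊥ rfl = refl

module FlatBooleans (em : Classical) where
  𝔹₀ : Dcpo
  𝔹₀ = 𝔹ᵈ em

  open Dcpo 𝔹₀ using (_≪_)

  -- By flatness, if no member reached `z`, then all members would be bottom, hence so would `z`,
  -- and any member would reach it. The index level is arbitrary so that this also covers the basis
  -- families, which are indexed in `Set₁`.
  attains-lub : {I : Set ℓ} (α : I → Bool⊥) → I → ∀ {z} → IsLub 𝔹-poset α z →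
                ∃ λ r → z ⊑ᵇ α r
  attains-lub {I = I} α r₀ {z} (ub , least) with em {P = ∃ λ r → z ⊑ᵇ α r}
  ... | yes p = p
  ... | no ¬p = r₀ , subst (_⊑ᵇ α r₀) (sym (⊑⊥⇒≡⊥ (least ⊥ᵇ below-⊥))) ⊥⊑
    where
    strictly-below : ∀ {b} → b ⊑ᵇ z → ¬ (z ⊑ᵇ b) → b ⊑ᵇ ⊥ᵇ
    strictly-below ⊥⊑  _ = ⊥⊑
    strictly-below rfl q = ⊥-elim (q rfl)
    below-⊥ : ∀ r → α r ⊑ᵇ ⊥ᵇ
    below-⊥ r = strictly-below (ub r) (λ q → ¬p (r , q))

  ⊑⇒≪ : ∀ {b c} → b ⊑ᵇ c → b ≪ c
  ⊑⇒≪ b⊑c α (r₀ , _) z lub c⊑z =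
    let (r , z⊑αr) = attains-lub α r₀ lub
    in r , Dcpo.trans 𝔹₀ (Dcpo.trans 𝔹₀ b⊑c c⊑z) z⊑αr

  Monotone₂ : (Bool⊥ → Bool⊥ → Bool⊥) → Set 1ℓ
  Monotone₂ h = ∀ {a a′ b b′} → a ⊑ᵇ a′ → b ⊑ᵇ b′ → h a b ⊑ᵇ h a′ b′

  -- Each coordinate of a directed family attains its lub, and directedness supplies a single index
  -- at which both do.
  monotone⇒continuous : (h : Bool⊥ → Bool⊥ → Bool⊥) → Monotone₂ h →
                        ContinuousMap (𝔹₀ ×ᵈ 𝔹₀) 𝔹₀
  monotone⇒continuous h h-mono = continuous (λ (a , b) → h a b)
    λ α (r₀ , dir) (x , y) (ub , least) →
      let (r , x⊑) = attains-lub (proj₁ ∘ α) r₀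
                       (proj₁ ∘ ub , λ z z-ub → proj₁ (least (z , y) λ r → z-ub r , proj₂ (ub r)))
          (s , y⊑) = attains-lub (proj₂ ∘ α) r₀
                       (proj₂ ∘ ub , λ z z-ub → proj₂ (least (x , z) λ r → proj₁ (ub r) , z-ub r))
          (t , r≤t , s≤t) = dir r s
      in (λ r → h-mono (proj₁ (ub r)) (proj₂ (ub r)))
       , λ z z-ub → Dcpo.trans 𝔹₀
           (h-mono (Dcpo.trans 𝔹₀ x⊑ (proj₁ r≤t)) (Dcpo.trans 𝔹₀ y⊑ (proj₂ s≤t)))
           (z-ub t)

  module _ (given : EffectivePresentation 𝔹₀) where
    open EffectivePresentation given
    open WayBelow 𝔹₀ using (≪⇒≤)

    -- `b` is the lub of the basis elements way below it, and in the flat booleans a lub is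
    -- attained.
    basis-surjective : ∀ b → ∃ λ j → basis j ≡ b
    basis-surjective b =
      let ((j , j≪b) , b⊑j) = attains-lub _ (proj₁ (basis-directed b)) (basis-lub b)
      in j , Dcpo.antisym 𝔹₀ (≪⇒≤ j≪b) b⊑j

-- guard 0ᵇ and guard 1ᵇ are sequential conjunction and implication.
guard : Bool⊥ → Bool⊥ → Bool⊥ → Bool⊥
guard c ⊥ᵇ b = ⊥ᵇ
guard c 0ᵇ b = c
guard c 1ᵇ b = b

guard-mono : ∀ c {a a′ b b′} → a ⊑ᵇ a′ → b ⊑ᵇ b′ → guard c a b ⊑ᵇ guard c a′ b′
guard-mono c ⊥⊑         q = ⊥⊑
guard-mono c (rfl {⊥ᵇ}) q = rfl
guard-mono c (rfl {0ᵇ}) q = rfl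
guard-mono c (rfl {1ᵇ}) q = q

-- Definedness of `b` is demanded only when `a` is 1; this is what lets a predicate defined just on
-- `K ∩ F` yield one defined on `K`.
guard-defined : ∀ {c a b} → ¬ (c ≡ ⊥ᵇ) → ¬ (a ≡ ⊥ᵇ) → (a ≡ 1ᵇ → ¬ (b ≡ ⊥ᵇ)) →
                ¬ (guard c a b ≡ ⊥ᵇ)
guard-defined {a = ⊥ᵇ} c↓ a↓ b↓ = a↓
guard-defined {a = 0ᵇ} c↓ a↓ b↓ = c↓
guard-defined {a = 1ᵇ} c↓ a↓ b↓ = b↓ refl

guard1≡1 : ∀ {a b} → ¬ (a ≡ ⊥ᵇ) → (a ≡ 1ᵇ → b ≡ 1ᵇ) → guard 1ᵇ a b ≡ 1ᵇ
guard1≡1 {⊥ᵇ} a↓ h = ⊥-elim (a↓ refl)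
guard1≡1 {0ᵇ} a↓ h = refl
guard1≡1 {1ᵇ} a↓ h = h refl

guard0≡1 : ∀ a b → guard 0ᵇ a b ≡ 1ᵇ → a ≡ 1ᵇ × b ≡ 1ᵇ
guard0≡1 1ᵇ _ e = refl , e

-- Combinators of the category

module Combinators {em : Classical} (𝒞 : CartesianClosedCategory em o) where
  open CartesianClosedCategory 𝒞
  open FlatBooleans em

  infixr 9 _⊚_
  _⊚_ : {C D E : EffectiveDomain} → ComputableMap D E → ComputableMap C D → ComputableMap C E
  _⊚_ = compose em

  -- The graph of `h` is a finite union of r.e. relations, one for each row `a`, `b` of its truth
  -- table. Since the presentation of the product is abstract, a row inspects a basis element only
  -- through the computable projections.
  monotone⇒computable : (h : Bool⊥ → Bool⊥ → Bool⊥) → Monotone₂ h →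
    ∃ λ (g : ComputableMap (𝔹-object ⊗ 𝔹-object) 𝔹) → ∀ a b → g · (a , b) ≡ h a b
  monotone⇒computable h h-mono =
    record { map = map-h ; isComputable = re-resp-⇔ (λ m n → mk⇔ (forth m n) (back m n)) re }
    , λ _ _ → refl
    where
    module P = EffectiveDomain (𝔹-object ⊗ 𝔹-object)
    open EffectiveDomain 𝔹 using (basis; _≪_; ≪-re)
    open WayBelow 𝔹₀ using (≪⇒≤)

    fst = proj₁ (π₁ 𝔹-object 𝔹-object)
    snd = proj₁ (π₂ 𝔹-object 𝔹-object)
    map-h = monotone⇒continuous h h-mono
    code = λ b → proj₁ (basis-surjective 𝔹-given b)
    decode : ∀ b → basis (code b) ≡ b
    decode b = proj₂ (basis-surjective 𝔹-given b)

    Table : Bool⊥ → Bool⊥ → ℕ → ℕ → Set 1ℓ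
    Table a b m n = (basis (code a) ≪ fst · P.basis n × basis (code b) ≪ snd · P.basis n)
                  × basis m ≪ basis (code (h a b))

    re : RecursivelyEnumerable (λ m n → ∃ λ a → ∃ λ b → Table a b m n)
    re = re-∃ᵇ λ a → re-∃ᵇ λ b → re-∩
      (re-∩ (re-fixˡ (code a) (isComputable fst)) (re-fixˡ (code b) (isComputable snd)))
      (re-fixʳ (code (h a b)) ≪-re)

    forth : ∀ m n → (∃ λ a → ∃ λ b → Table a b m n) → basis m ≪ map-h ∙ P.basis n
    forth m n (a , b , (p , q) , r) = ⊑⇒≪ (Dcpo.trans 𝔹₀
      (subst (basis m ⊑ᵇ_) (decode (h a b)) (≪⇒≤ r))
      (h-mono (subst₂ _⊑ᵇ_ (decode a) (proj₂ (π₁ 𝔹-object 𝔹-object) _ _) (≪⇒≤ p))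
              (subst₂ _⊑ᵇ_ (decode b) (proj₂ (π₂ 𝔹-object 𝔹-object) _ _) (≪⇒≤ q))))

    back : ∀ m n → basis m ≪ map-h ∙ P.basis n → ∃ λ a → ∃ λ b → Table a b m n
    back m n p =
      -- The matching row is given by the actual coordinates; as every boolean is compact, `≤` there
      -- already gives `≪`.
      let (a , b) = P.basis n
      in a , b
       , ( ⊑⇒≪ (Dcpo.reflexive 𝔹₀ (trans (decode a) (sym (proj₂ (π₁ 𝔹-object 𝔹-object) a b))))
         , ⊑⇒≪ (Dcpo.reflexive 𝔹₀ (trans (decode b) (sym (proj₂ (π₂ 𝔹-object 𝔹-object) a b)))))
       , ⊑⇒≪ (subst (basis m ⊑ᵇ_) (sym (decode (h a b))) (≪⇒≤ p))

  module _ {C : EffectiveDomain} (Z : Object C) where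

    guardᶜ : ∀ c (g h : ComputableMap C 𝔹) →
             ∃ λ (u : ComputableMap C 𝔹) → ∀ z → u · z ≡ guard c (g · z) (h · z)
    guardᶜ c g h =
      let (gd , gd≡) = monotone⇒computable (guard c) (guard-mono c)
          (u , u≈) = pair Z 𝔹-object 𝔹-object g h
      in gd ⊚ u , λ z → trans (gd≡ (proj₁ (u · z)) (proj₂ (u · z)))
           (cong₂ (guard c) (proj₁ (u≈ z)) (proj₂ (u≈ z)))

    evalᶜ : ∀ {D} (A : Object D) (g : ComputableMap C (A ⇒ 𝔹-object)) (h : ComputableMap C D) →
            ∃ λ (u : ComputableMap C 𝔹) → ∀ z → u · z ≡ (g · z) ∙ (h · z)
    evalᶜ A g h =
      let (ev , ev≡) = eval A 𝔹-object
          (u , u≈) = pair Z (⇒-object A 𝔹-object) A g h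
      in ev ⊚ u , λ z → trans (∙-cong (map ev) (u≈ z)) (ev≡ (g · z) (h · z))

  module _ {D : EffectiveDomain} (A : Object D) (ψ : ComputableMap D 𝔹) where
    private
      A⇒𝔹 = ⇒-object A 𝔹-object
      A⇒𝔹×A = ×-object A⇒𝔹 A

    relativise : ∀ c → ∃ λ (u : ComputableMap (A ⇒ 𝔹-object) (A ⇒ 𝔹-object)) →
                 ∀ p x → (u · p) ∙ x ≡ guard c (ψ · x) (p ∙ x)
    relativise c =
      let (snd , snd≈) = π₂ A⇒𝔹 A
          (ev , ev≡) = eval A 𝔹-object
          (v , v≡) = guardᶜ A⇒𝔹×A c (ψ ⊚ snd) ev
          (u , u≡) = curry A⇒𝔹 A 𝔹-object v
      in u , λ p x → trans (u≡ p x) (trans (v≡ (p , x))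
           (cong₂ (guard c) (∙-cong (map ψ) (snd≈ p x)) (ev≡ p x)))

    -- The value `e · p` does not depend on `x` and acts as a switch: at 1 the new predicate is the
    -- conjunction of `ψ` and `p`, at 0 it is `ψ` alone.
    relativise-weakened : (e : ComputableMap (A ⇒ 𝔹-object) 𝔹) →
      ∃ λ (u : ComputableMap (A ⇒ 𝔹-object) (A ⇒ 𝔹-object)) →
      ∀ p x → (u · p) ∙ x ≡ guard 0ᵇ (ψ · x) (guard 1ᵇ (e · p) (p ∙ x))
    relativise-weakened e =
      let (fst , fst≈) = π₁ A⇒𝔹 A
          (snd , snd≈) = π₂ A⇒𝔹 A
          (ev , ev≡) = eval A 𝔹-object
          (w , w≡) = guardᶜ A⇒𝔹×A 1ᵇ (e ⊚ fst) ev
          (v , v≡) = guardᶜ A⇒𝔹×A 0ᵇ (ψ ⊚ snd) w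
          (u , u≡) = curry A⇒𝔹 A 𝔹-object v
      in u , λ p x → trans (u≡ p x) (trans (v≡ (p , x))
           (cong₂ (guard 0ᵇ) (∙-cong (map ψ) (snd≈ p x))
             (trans (w≡ (p , x))
               (cong₂ (guard 1ᵇ) (∙-cong (map e) (fst≈ p x)) (ev≡ p x)))))

-- Quantification and search over a decidable subset

module _ {em : Classical} (𝒞 : CartesianClosedCategory em o) {D : EffectiveDomain}
         (A : CartesianClosedCategory.Object 𝒞 D)
         (K : Pred ∣ EffectiveDomain.dcpo D ∣ k) (F : Pred ∣ EffectiveDomain.dcpo D ∣ f)
         (dec : DecidableOn 𝒞 A K F) where
  open CartesianClosedCategory 𝒞
  open Combinators 𝒞
  private
    ψ = proj₁ dec
    ψ-defined : ∀ {x} → x ∈ K → ¬ (ψ · x ≡ ⊥ᵇ)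
    ψ-defined = proj₁ (proj₂ dec)
    ψ⇒F : ∀ {x} → x ∈ K → ψ · x ≡ 1ᵇ → x ∈ F
    ψ⇒F x∈K = to (proj₂ (proj₂ dec) x∈K)
    F⇒ψ : ∀ {x} → x ∈ K → x ∈ F → ψ · x ≡ 1ᵇ
    F⇒ψ x∈K = from (proj₂ (proj₂ dec) x∈K)

  -- Points of `K` outside `F` satisfy the implication vacuously, while a counterexample in `K ∩ F`
  -- remains one.
  exhaustible-∩ : Exhaustible 𝒞 A K → Exhaustible 𝒞 A (K ∩ F)
  exhaustible-∩ (∀ᴷ , spec) = ∀ᴷ ⊚ u , λ p p-defined →
    let q-defined : DefinedOn 𝒞 {D = D} (u · p) K
        q-defined {x} x∈K e = guard-defined (λ ()) (ψ-defined x∈K)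
          (λ ψx≡1 → p-defined (x∈K , ψ⇒F x∈K ψx≡1)) (trans (sym (u≡ p x)) e)
        (all , some) = spec (u · p) q-defined
    in (λ h → all λ {x} x∈K → trans (u≡ p x)
          (guard1≡1 (ψ-defined x∈K) λ ψx≡1 → h (x∈K , ψ⇒F x∈K ψx≡1)))
     , (λ { (x , (x∈K , x∈F) , px≡0) → some (x , x∈K , trans (u≡ p x)
          (cong₂ (guard 1ᵇ) (F⇒ψ x∈K x∈F) px≡0)) })
    where
    u = proj₁ (relativise A ψ 1ᵇ)
    u≡ = proj₂ (relativise A ψ 1ᵇ)

  searchable-∩ : Satisfiable (K ∩ F) → Searchable 𝒞 A K → Searchable 𝒞 A (K ∩ F)
  searchable-∩ (x₀ , x₀∈K , x₀∈F) (ε , spec) = ε ⊚ q , correct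
    where
    conj = relativise A ψ 0ᵇ
    r = proj₁ conj
    r≡ = proj₂ conj

    -- Testing the conjunction at the point that `ε` proposes for it decides whether `p` has a
    -- solution in `K ∩ F`.
    solvable = evalᶜ (⇒-object A 𝔹-object) A r (ε ⊚ r)
    e = proj₁ solvable
    e≡ = proj₂ solvable

    weakened = relativise-weakened A ψ e
    q = proj₁ weakened
    q≡ = proj₂ weakened

    module _ (p : ContinuousMap (EffectiveDomain.dcpo D) (EffectiveDomain.dcpo 𝔹))
             (p-defined : DefinedOn 𝒞 {D = D} p (K ∩ F)) where
      r-defined : DefinedOn 𝒞 {D = D} (r · p) K
      r-defined {x} x∈K eq = guard-defined (λ ()) (ψ-defined x∈K)
        (λ ψx≡1 → p-defined (x∈K , ψ⇒F x∈K ψx≡1)) (trans (sym (r≡ p x)) eq)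

      y = ε · (r · p)
      y∈K = proj₁ (spec (r · p) r-defined)

      e-defined : ¬ (e · p ≡ ⊥ᵇ)
      e-defined eq = r-defined y∈K (trans (sym (e≡ p)) eq)

      q-defined : DefinedOn 𝒞 {D = D} (q · p) K
      q-defined {x} x∈K eq =
        guard-defined {0ᵇ} {ψ · x} {guard 1ᵇ (e · p) (p ∙ x)} (λ ()) (ψ-defined x∈K)
        (λ ψx≡1 → guard-defined {1ᵇ} {e · p} {p ∙ x} (λ ()) e-defined
          (λ _ → p-defined (x∈K , ψ⇒F x∈K ψx≡1)))
        (trans (sym (q≡ p x)) eq)

      -- Whatever the value of the switch, a solution exists, so `ε` must return one, and every
      -- solution in `K` satisfies `ψ`. At 0 the given point `x₀` of `K ∩ F` serves; at 1 the point
      -- `y` found for the conjunction does.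
      q-satisfiable : ∀ b → e · p ≡ b → ∃ λ x → x ∈ K × (q · p) ∙ x ≡ 1ᵇ
      q-satisfiable ⊥ᵇ e≡⊥ = ⊥-elim (e-defined e≡⊥)
      q-satisfiable 0ᵇ e≡0 = x₀ , x₀∈K , trans (q≡ p x₀)
        (cong₂ (guard 0ᵇ) (F⇒ψ x₀∈K x₀∈F) (cong (λ b → guard 1ᵇ b (p ∙ x₀)) e≡0))
      q-satisfiable 1ᵇ e≡1 =
        let (ψy≡1 , py≡1) = guard0≡1 (ψ · y) (p ∙ y)
              (trans (sym (r≡ p y)) (trans (sym (e≡ p)) e≡1))
        in y , y∈K , trans (q≡ p y) (cong₂ (guard 0ᵇ) ψy≡1 (cong₂ (guard 1ᵇ) e≡1 py≡1))

      correct : ε · (q · p) ∈ K ∩ F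
              × ((∃ λ x → x ∈ K ∩ F × p ∙ x ≡ 1ᵇ) → p ∙ (ε · (q · p)) ≡ 1ᵇ)
      correct =
        let z = ε · (q · p)
            (z∈K , q-search) = spec (q · p) q-defined
            (ψz≡1 , e⇒pz≡1) = guard0≡1 (ψ · z) (guard 1ᵇ (e · p) (p ∙ z))
              (trans (sym (q≡ p z)) (q-search (q-satisfiable _ refl)))
        in (z∈K , ψ⇒F z∈K ψz≡1)
         , λ { (x , (x∈K , x∈F) , px≡1) →
             -- A solution `x` in `K ∩ F` also solves the conjunction, so the switch is 1 and the
             -- inner implication at `z` reduces to `p ∙ z`.
             let e≡1 = trans (e≡ p) (proj₂ (spec (r · p) r-defined) (x , x∈K ,
                         trans (r≡ p x) (cong₂ (guard 0ᵇ) (F⇒ψ x∈K x∈F) px≡1)))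
             in trans (cong (λ b → guard 1ᵇ b (p ∙ z)) (sym e≡1)) e⇒pz≡1 }

proposition4p2 : ∀ {o k f} (em : Classical) (𝒞 : CartesianClosedCategory em o) →
    {D : EffectiveDomain} (A : CartesianClosedCategory.Object 𝒞 D)
    (K : Pred ∣ EffectiveDomain.dcpo D ∣ k)
    (F : Pred ∣ EffectiveDomain.dcpo D ∣ f) →
    F ⊆ K → DecidableOn 𝒞 A K F →
    (Exhaustible 𝒞 A K → Exhaustible 𝒞 A (K ∩ F))
    × (Satisfiable (K ∩ F) → Searchable 𝒞 A K → Searchable 𝒞 A (K ∩ F))
proposition4p2 em 𝒞 A K F _ dec = exhaustible-∩ 𝒞 A K F dec , searchable-∩ 𝒞 A K F dec
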